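{- Let $I=(G,\chi,b)$ be a Global Label Min-Cut instance where $G=(V,E)$ is a loopless undirected multigraph with $|V|\ge2$, $\chi:E\to[p]$, and $b\le p$. In polynomial time, one can construct an instance $I^\sharp=(G^\sharp,\chi^\sharp,b)$ of Global Label Min-Cut in which $G^\sharp$ is a simple graph, such that \[ I\text{ is a Yes-instance}\quad\Longleftrightarrow\quad I^\sharp\text{ is a Yes-instance}. \] Moreover, \[ \mathrm{OPT}(G^\sharp,\chi^\sharp)=\mathrm{OPT}(G,\chi). \]
   Context: Global Label Min-Cut: the input is an undirected multigraph $G=(V,E)$ (parallel edges counted separately), a labeling $\chi:E\to[p]=\{1,\dots,p\}$, and a budget $b\in\{0,\dots,p\}$. For $\varnothing\neq S\subsetneq V$ let $\delta(S)=\{uv\in E:u\in S,\ v\notin S\}$ and $\chi(\delta(S))=\{\chi(e):e\in\delta(S)\}$. The instance is a Yes-instance iff there is $\varnothing\neq S\subsetneq V$ with $|\chi(\delta(S))|\le b$. Define $\mathrm{OPT}(G,\chi)=\min_{\varnothing\neq S\subsetneq V}|\chi(\delta(S))|$. The labeling $\chi^\sharp$ may use a different (larger) number of labels than $\chi$. Polynomial time means polynomial in $|V|+|E|+p$. -}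

module Defs where

open import Data.Bool.Base using (if_then_else_)
open import Data.Fin.Base using (Fin; zero; suc; toℕ)
open import Data.Fin.Properties using (any?)
open import Data.Fin.Subset
  using (Subset; inside; outside; _∈_; _∉_; _⊂_; ⊤; ⁅_⁆; ∣_∣; Nonempty)
open import Data.Fin.Subset.Properties
  using (_∈?_; _⊂?_; nonempty?; ∈⊤; x∈⁅x⁆; x∈⁅y⁆⇒x≡y)
open import Data.List.Base
  using (List; []; _∷_; _++_; map; filter; concatMap; allFin)
open import Data.List.Extrema.Nat using (min; min≤xs; argmin-sel)
open import Data.List.Membership.Propositional
  using () renaming (_∈_ to _∈ₗ_)
open import Data.List.Membership.Propositional.Properties
  using (∈-++⁺ˡ; ∈-++⁺ʳ; ∈-map⁺; ∈-map⁻; ∈-filter⁺; ∈-filter⁻)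
open import Data.List.Relation.Unary.All as All using ()
open import Data.List.Relation.Unary.Any using (here)
open import Data.Nat.Base
  using (ℕ; zero; suc; _+_; _∸_; _≤_; s≤s; _≡ᵇ_)
open import Data.Product.Base using (∃-syntax; _×_; _,_; proj₁; proj₂)
open import Data.Sum.Base using (_⊎_; inj₁; inj₂)
open import Data.Vec.Base using (tabulate; []; _∷_)
open import Function.Base using (id)
open import Relation.Binary.PropositionalEquality using (_≡_; _≢_; refl; sym)
open import Relation.Nullary using (Dec; does; ¬_)
open import Relation.Nullary.Decidable using (_×-dec_; _⊎-dec_; ¬?)
import Data.Fin.Properties as Fin

------------------------------------------------------------------------
-- Multigraphs

-- Vertices and edges are named by Fin nV and Fin nE, so parallel edges are
-- distinct elements.  Each edge lists its endpoints in some order; no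
-- notion below depends on that order.
record Multigraph : Set where
  field
    nV   : ℕ
    nE   : ℕ
    ends : Fin nE → Fin nV × Fin nV

open Multigraph public

Loopless : Multigraph → Set
Loopless G = ∀ e → proj₁ (ends G e) ≢ proj₂ (ends G e)

Parallel : (G : Multigraph) → Fin (nE G) → Fin (nE G) → Set
Parallel G e f = ends G e ≡ ends G f
               ⊎ ends G e ≡ (proj₂ (ends G f) , proj₁ (ends G f))

Simple : Multigraph → Set
Simple G = Loopless G × (∀ e f → Parallel G e f → e ≡ f)

------------------------------------------------------------------------
-- Cuts and their labels

Proper : ∀ {n} → Subset n → Set
Proper S = Nonempty S × S ⊂ ⊤

proper? : ∀ {n} (S : Subset n) → Dec (Proper S)
proper? S = nonempty? S ×-dec (S ⊂? ⊤)

Crosses : (G : Multigraph) → Subset (nV G) → Fin (nE G) → Set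
Crosses G S e = let u , v = ends G e in (u ∈ S × v ∉ S) ⊎ (v ∈ S × u ∉ S)

crosses? : ∀ G S e → Dec (Crosses G S e)
crosses? G S e = let u , v = ends G e in
  ((u ∈? S) ×-dec ¬? (v ∈? S)) ⊎-dec ((v ∈? S) ×-dec ¬? (u ∈? S))

δ : (G : Multigraph) → Subset (nV G) → Subset (nE G)
δ G S = tabulate λ e → does (crosses? G S e)

Labeling : Multigraph → ℕ → Set
Labeling G p = Fin (nE G) → Fin p

image : ∀ {m p} → (Fin m → Fin p) → Subset m → Subset p
image χ F = tabulate λ ℓ → does (any? λ e → (e ∈? F) ×-dec (χ e Fin.≟ ℓ))

-- |χ(δ(S))|
cutLabels : (G : Multigraph) {p : ℕ} → Labeling G p → Subset (nV G) → ℕ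
cutLabels G χ S = ∣ image χ (δ G S) ∣

allSubsets : ∀ n → List (Subset n)
allSubsets zero    = [] ∷ []
allSubsets (suc n) = map (outside ∷_) (allSubsets n) ++ map (inside ∷_) (allSubsets n)

firstVertex : ∀ {n} → 2 ≤ n → Fin n
firstVertex (s≤s _) = zero

-- The minimum exists only when there are at least two vertices.  As min
-- takes a starting value, we start from the value of one particular
-- admissible set; see OPT-attained and OPT-minimal.
OPT : (G : Multigraph) → 2 ≤ nV G → {p : ℕ} → Labeling G p → ℕ
OPT G n≥2 χ = min (cutLabels G χ ⁅ firstVertex n≥2 ⁆)
                  (map (cutLabels G χ) (filter proper? (allSubsets (nV G))))

allSubsets-complete : ∀ {n} (S : Subset n) → S ∈ₗ allSubsets n
allSubsets-complete []            = here refl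
allSubsets-complete (outside ∷ S) = ∈-++⁺ˡ (∈-map⁺ (outside ∷_) (allSubsets-complete S))
allSubsets-complete (inside ∷ S)  =
  ∈-++⁺ʳ (map (outside ∷_) (allSubsets _)) (∈-map⁺ (inside ∷_) (allSubsets-complete S))

firstVertex-proper : ∀ {n} (n≥2 : 2 ≤ n) → Proper ⁅ firstVertex n≥2 ⁆
firstVertex-proper (s≤s (s≤s _)) =
  (zero , x∈⁅x⁆ zero) , (λ _ → ∈⊤) , suc zero , ∈⊤ , λ 1∈ → 1≢0 (x∈⁅y⁆⇒x≡y zero 1∈)
  where
  1≢0 : ∀ {n} → ¬ (Fin.suc {suc n} zero ≡ zero)
  1≢0 ()

OPT-attained : ∀ G n≥2 {p} (χ : Labeling G p) →
               ∃[ S ] Proper S × cutLabels G χ S ≡ OPT G n≥2 χ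
OPT-attained G n≥2 χ
  with argmin-sel id (cutLabels G χ ⁅ firstVertex n≥2 ⁆)
         (map (cutLabels G χ) (filter proper? (allSubsets (nV G))))
... | inj₁ eq = _ , firstVertex-proper n≥2 , sym eq
... | inj₂ m∈ with ∈-map⁻ (cutLabels G χ) m∈
...   | S , S∈ , eq = S , proj₂ (∈-filter⁻ proper? {xs = allSubsets (nV G)} S∈) , sym eq

OPT-minimal : ∀ G n≥2 {p} (χ : Labeling G p) S → Proper S →
              OPT G n≥2 χ ≤ cutLabels G χ S
OPT-minimal G n≥2 χ S proper =
  All.lookup (min≤xs _ (map (cutLabels G χ) (filter proper? (allSubsets (nV G)))))
             (∈-map⁺ (cutLabels G χ) (∈-filter⁺ proper? (allSubsets-complete S) proper))

------------------------------------------------------------------------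
-- Global Label Min-Cut

record Instance : Set where
  field
    G   : Multigraph
    p   : ℕ
    χ   : Labeling G p
    b   : ℕ
    b≤p : b ≤ p

open Instance public

YesInstance : Instance → Set
YesInstance I = ∃[ S ] Proper S × cutLabels (G I) (χ I) S ≤ b I

size : Instance → ℕ
size I = nV (G I) + nE (G I) + p I

-- |V|, |E|, p, b, and then two endpoints and a label for every edge.
encode : Instance → List ℕ
encode I = nV (G I) ∷ nE (G I) ∷ p I ∷ b I ∷ concatMap edge (allFin (nE (G I)))
  where
  edge : Fin (nE (G I)) → List ℕ
  edge e = toℕ (proj₁ (ends (G I) e)) ∷ toℕ (proj₂ (ends (G I) e)) ∷ toℕ (χ I e) ∷ []

------------------------------------------------------------------------
-- Random access machines

-- The Cook–Reckhow RAM (cells X₀, X₁, … holding naturals; addition and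
-- truncated subtraction, but no multiplication, so that the uniform cost
-- used here is polynomially related to Turing machine time), with
-- structured control in place of conditional jumps.
infixr 5 _⨾_

data Program : Set where
  const : (i c : ℕ) → Program                     -- Xᵢ ← c
  add   : (i j k : ℕ) → Program                   -- Xᵢ ← Xⱼ + Xₖ
  sub   : (i j k : ℕ) → Program                   -- Xᵢ ← Xⱼ ∸ Xₖ
  load  : (i j : ℕ) → Program                     -- Xᵢ ← X_{Xⱼ}
  store : (i j : ℕ) → Program                     -- X_{Xᵢ} ← Xⱼ
  read  : (i : ℕ) → Program                       -- Xᵢ ← next input number
  print : (i : ℕ) → Program                       -- append Xᵢ to the output
  _⨾_   : Program → Program → Program
  ifnz  : (i : ℕ) → Program → Program → Program   -- first branch when Xᵢ ≠ 0
  while : (i : ℕ) → Program → Program             -- repeat as long as Xᵢ ≠ 0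

record State : Set where
  constructor ⟪_,_,_⟫
  field
    mem : ℕ → ℕ
    inp : List ℕ
    out : List ℕ

open State public

infixl 6 _[_≔_]

_[_≔_] : (ℕ → ℕ) → ℕ → ℕ → (ℕ → ℕ)
(X [ i ≔ x ]) j = if i ≡ᵇ j then x else X j

infix 4 ⟨_,_⟩⇓[_]_

-- ⟨ P , s ⟩⇓[ t ] s′ : started in s, P halts in s′ after t steps.  Every
-- elementary instruction and every evaluation of a test is one step.
data ⟨_,_⟩⇓[_]_ : Program → State → ℕ → State → Set where
  const⇓ : ∀ {i c X xs ys} →
    ⟨ const i c , ⟪ X , xs , ys ⟫ ⟩⇓[ 1 ] ⟪ X [ i ≔ c ] , xs , ys ⟫
  add⇓   : ∀ {i j k X xs ys} →
    ⟨ add i j k , ⟪ X , xs , ys ⟫ ⟩⇓[ 1 ] ⟪ X [ i ≔ X j + X k ] , xs , ys ⟫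
  sub⇓   : ∀ {i j k X xs ys} →
    ⟨ sub i j k , ⟪ X , xs , ys ⟫ ⟩⇓[ 1 ] ⟪ X [ i ≔ X j ∸ X k ] , xs , ys ⟫
  load⇓  : ∀ {i j X xs ys} →
    ⟨ load i j , ⟪ X , xs , ys ⟫ ⟩⇓[ 1 ] ⟪ X [ i ≔ X (X j) ] , xs , ys ⟫
  store⇓ : ∀ {i j X xs ys} →
    ⟨ store i j , ⟪ X , xs , ys ⟫ ⟩⇓[ 1 ] ⟪ X [ X i ≔ X j ] , xs , ys ⟫
  read⇓  : ∀ {i X x xs ys} →
    ⟨ read i , ⟪ X , x ∷ xs , ys ⟫ ⟩⇓[ 1 ] ⟪ X [ i ≔ x ] , xs , ys ⟫
  read[]⇓ : ∀ {i X ys} →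
    ⟨ read i , ⟪ X , [] , ys ⟫ ⟩⇓[ 1 ] ⟪ X [ i ≔ 0 ] , [] , ys ⟫
  print⇓ : ∀ {i X xs ys} →
    ⟨ print i , ⟪ X , xs , ys ⟫ ⟩⇓[ 1 ] ⟪ X , xs , ys ++ X i ∷ [] ⟫
  ⨾⇓     : ∀ {P Q s s′ s″ t t′} →
    ⟨ P , s ⟩⇓[ t ] s′ → ⟨ Q , s′ ⟩⇓[ t′ ] s″ →
    ⟨ P ⨾ Q , s ⟩⇓[ t + t′ ] s″
  ifnz⇓  : ∀ {i P Q s s′ t} → mem s i ≢ 0 →
    ⟨ P , s ⟩⇓[ t ] s′ → ⟨ ifnz i P Q , s ⟩⇓[ suc t ] s′
  ifz⇓   : ∀ {i P Q s s′ t} → mem s i ≡ 0 →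
    ⟨ Q , s ⟩⇓[ t ] s′ → ⟨ ifnz i P Q , s ⟩⇓[ suc t ] s′
  stop⇓  : ∀ {i P s} → mem s i ≡ 0 →
    ⟨ while i P , s ⟩⇓[ 1 ] s
  loop⇓  : ∀ {i P s s′ s″ t t′} → mem s i ≢ 0 →
    ⟨ P , s ⟩⇓[ t ] s′ → ⟨ while i P , s′ ⟩⇓[ t′ ] s″ →
    ⟨ while i P , s ⟩⇓[ suc (t + t′) ] s″

initial : List ℕ → State
initial xs = ⟪ (λ _ → 0) , xs , [] ⟫

-- encode writes |V| and p as single numbers, so a short output could
-- describe a huge instance; hence the size of J is bounded as well.
ConstructsWithin : Program → ℕ → Instance → Instance → Set
ConstructsWithin P B I J =
  size J ≤ B ×
  ∃[ t ] ∃[ s ] ⟨ P , initial (encode I) ⟩⇓[ t ] s × out s ≡ encode J × t ≤ B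

{-# OPTIONS --safe #-}

-- Every vertex v is blown up into a complete bipartite graph K_{N,N} with
-- N = |E| + 1, in which the edge from hub i to leaf j carries a new label
-- (i , j), the same for all v; the e-th edge of G joins the e-th hubs of
-- its two endpoints and keeps its label, so parallel edges are pulled
-- apart.  A cut that splits some block meets N > |E| labels, more than any
-- cut of G; a cut that splits no block is a cut of G with the same labels.
-- A RAM lists this graph with nested loops; numbering vertex v of layer i
-- as i * |V| + v turns every product into a running sum.

module Submission where

open import Defs
open import Data.Bool.Base using (Bool; true; false; T)
import Data.Bool.Properties as Bool
open import Data.Fin using (#_)
open import Data.Fin.Base
  using (Fin; zero; suc; toℕ; _↑ˡ_; _↑ʳ_; splitAt; join; combine; remQuot; inject≤; fromℕ<)
open import Data.Fin.Properties as Fin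
  using (any?; all?; splitAt-↑ˡ; splitAt-↑ʳ; splitAt⁻¹-↑ˡ; splitAt⁻¹-↑ʳ; splitAt-join; join-splitAt;
         ↑ˡ-injective; ↑ʳ-injective; inject≤-injective; remQuot-combine; combine-remQuot;
         combine-injective; ¬∀⟶∃¬)
open import Data.Fin.Subset using (Subset; inside; outside; _∈_; ⊤; ∣_∣; _-_)
open import Data.Fin.Subset.Properties
  using (_∈?_; ∈⊤; x∈p⇒∣p-x∣<∣p∣; x∈p∧x≢y⇒x∈p-y; ∣⊤∣≡n)
open import Data.List.Base as List using (List; []; _∷_; _++_; concatMap; allFin)
import Data.List.Properties as List
open import Data.Nat.Base using (ℕ; zero; suc; _+_; _*_; _^_; _∸_; _≤_; _<_; s≤s; z≤n; _≡ᵇ_)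
import Data.Nat.Properties as ℕ
open import Data.Nat.Solver using (module +-*-Solver)
open import Data.Product.Base
  using (Σ-syntax; ∃-syntax; _×_; _,_; proj₁; proj₂; uncurry; swap)
open import Data.Product.Properties using (,-injectiveˡ; ,-injectiveʳ)
open import Data.Sum.Base as Sum using (_⊎_; inj₁; inj₂)
open import Data.Sum.Properties using (inj₁-injective)
open import Data.Unit.Base using (tt)
open import Data.Vec.Base as Vec
  using (Vec; lookup; tabulate; []; _∷_; here; there; _[_]≔_; toList)
open import Data.Vec.Properties
  using (lookup∘tabulate; lookup⇒[]=; []=⇒lookup; lookup∘update; lookup∘update′; lookup-replicate)
open import Function.Base using (_∘_; id)
open import Function.Bundles using (_⇔_; mk⇔)
open import Relation.Binary.PropositionalEquality
open import Relation.Nullary using (yes; no; does; contradiction)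
open import Relation.Nullary.Decidable using (dec-true; decidable-stable; ¬?; _×-dec_)
open import Relation.Unary using (Decidable)

-- Cuts and their labels

∈-tabulate⁺ : ∀ {n} {P : Fin n → Set} (P? : Decidable P) {i} → P i → i ∈ tabulate (does ∘ P?)
∈-tabulate⁺ P? {i} pi =
  lookup⇒[]= i _ (trans (lookup∘tabulate (does ∘ P?) i) (dec-true (P? i) pi))

∈-tabulate⁻ : ∀ {n} {P : Fin n → Set} (P? : Decidable P) {i} → i ∈ tabulate (does ∘ P?) → P i
∈-tabulate⁻ P? {i} i∈ with P? i | trans (sym (lookup∘tabulate (does ∘ P?) i)) ([]=⇒lookup i∈)
... | yes pi | _ = pi

-- Induction on `A`: the partner of its first member is struck from `B`, and by injectivity no later
-- member is related to that partner. A relation fits better than a function, since partners exist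
-- only for members of `A` and one label may sit on many edges.
∣∣-mono-injection : ∀ {m n} (R : Fin m → Fin n → Set) {A : Subset m} {B : Subset n} →
  (∀ {a} → a ∈ A → ∃[ b ] b ∈ B × R a b) →
  (∀ {a a′ b} → R a b → R a′ b → a ≡ a′) → ∣ A ∣ ≤ ∣ B ∣
∣∣-mono-injection R {[]} total inj = z≤n
∣∣-mono-injection R {outside ∷ A} total inj =
  ∣∣-mono-injection (R ∘ suc) (total ∘ there) λ r r′ → Fin.suc-injective (inj r r′)
∣∣-mono-injection R {inside ∷ A} total inj with total here
... | b , b∈B , r₀ = ℕ.≤-trans (s≤s (∣∣-mono-injection (R ∘ suc) total′ inj′)) (x∈p⇒∣p-x∣<∣p∣ b∈B)
  where
  inj′ : ∀ {a a′ b} → R (suc a) b → R (suc a′) b → a ≡ a′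
  inj′ r r′ = Fin.suc-injective (inj r r′)
  total′ : ∀ {a} → a ∈ A → ∃[ c ] c ∈ _ - b × R (suc a) c
  total′ a∈A with total (there a∈A)
  ... | c , c∈B , r = c , x∈p∧x≢y⇒x∈p-y c∈B (λ { refl → Fin.0≢1+n (inj r₀ r) }) , r

lookup≡⇒∈ : ∀ {n} {S : Subset n} {u v} → lookup S u ≡ lookup S v → u ∈ S → v ∈ S
lookup≡⇒∈ {S = S} {v = v} eq u∈ = lookup⇒[]= v S (trans (sym eq) ([]=⇒lookup u∈))

module _ (G : Multigraph) (S : Subset (nV G)) where

  -- Crossing as an inequality of Booleans: one symmetric condition in place of two cases, refuted
  -- or transported by equations between lookups.
  Separates : Fin (nE G) → Set
  Separates e = lookup S (proj₁ (ends G e)) ≢ lookup S (proj₂ (ends G e))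

  crosses⇒separates : ∀ {e} → Crosses G S e → Separates e
  crosses⇒separates (inj₁ (u∈ , v∉)) eq = v∉ (lookup≡⇒∈ eq u∈)
  crosses⇒separates (inj₂ (v∈ , u∉)) eq = u∉ (lookup≡⇒∈ (sym eq) v∈)

  separates⇒crosses : ∀ {e} → Separates e → Crosses G S e
  separates⇒crosses {e} sep
    with lookup S (proj₁ (ends G e)) in equ | lookup S (proj₂ (ends G e)) in eqv
  ... | true  | true  = contradiction refl sep
  ... | true  | false =
    inj₁ (lookup⇒[]= _ S equ , λ v∈ → contradiction (trans (sym eqv) ([]=⇒lookup v∈)) λ ())
  ... | false | true  =
    inj₂ (lookup⇒[]= _ S eqv , λ u∈ → contradiction (trans (sym equ) ([]=⇒lookup u∈)) λ ())
  ... | false | false = contradiction refl sep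

  module _ {p} (χ : Labeling G p) where

    ∈-cutLabels⁺ : ∀ e → Separates e → χ e ∈ image χ (δ G S)
    ∈-cutLabels⁺ e sep =
      ∈-tabulate⁺ (λ ℓ → any? λ e → (e ∈? δ G S) ×-dec (χ e Fin.≟ ℓ))
        (e , ∈-tabulate⁺ (crosses? G S) (separates⇒crosses sep) , refl)

    ∈-cutLabels⁻ : ∀ {ℓ} → ℓ ∈ image χ (δ G S) → ∃[ e ] Separates e × χ e ≡ ℓ
    ∈-cutLabels⁻ ℓ∈ with ∈-tabulate⁻ (λ ℓ → any? λ e → (e ∈? δ G S) ×-dec (χ e Fin.≟ ℓ)) ℓ∈
    ... | e , e∈ , eq = e , crosses⇒separates (∈-tabulate⁻ (crosses? G S) e∈) , eq

    -- Each label is matched with a cut edge carrying it, and an edge carries only one label. This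
    -- is the bound that `N` has to exceed.
    cutLabels≤nE : cutLabels G χ S ≤ nE G
    cutLabels≤nE = subst (cutLabels G χ S ≤_) (∣⊤∣≡n (nE G))
      (∣∣-mono-injection (λ ℓ e → χ e ≡ ℓ)
        (λ ℓ∈ → let e , _ , eq = ∈-cutLabels⁻ ℓ∈ in e , ∈⊤ , eq)
        λ { refl refl → refl })

-- g and h give the sides of the hubs and of the leaves of K_{N,N}.
cut-K : ∀ {N} (g h : Fin N → Bool) →
  (∃[ j ] ∀ i → g i ≢ h (j i)) ⊎ (∃[ i ] ∀ j → g i ≢ h j) ⊎
  (∃[ x ] (∀ i → g i ≡ x) × (∀ j → h j ≡ x))
cut-K {N} g h with all? (λ i → any? (λ j → ¬? (g i Bool.≟ h j)))
... | yes f = inj₁ (proj₁ ∘ f , proj₂ ∘ f)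
... | no ¬f with any? (λ i → all? (λ j → ¬? (g i Bool.≟ h j)))
...   | yes p = inj₂ (inj₁ p)
...   | no ¬p with ¬∀⟶∃¬ N _ (λ i → any? λ j → ¬? (g i Bool.≟ h j)) ¬f
-- Hub `i₀` sees no leaf on the other side, so all leaves share its side. A hub on the other side
-- would then differ from every leaf, which `¬p` excludes.
...     | i₀ , ¬cross = inj₂ (inj₂ (g i₀ , hubs , leaves))
  where
  leaves : ∀ j → h j ≡ g i₀
  leaves j = sym (decidable-stable (g i₀ Bool.≟ h j) λ ≢ → ¬cross (j , ≢))
  hubs : ∀ i → g i ≡ g i₀
  hubs i = decidable-stable (g i Bool.≟ g i₀) λ ≢ → ¬p (i , λ j eq → ≢ (trans eq (leaves j)))

-- The blown-up graph

module Blowup (G : Multigraph) {p : ℕ} (χ : Labeling G p) (N : ℕ) (m<N : nE G < N) where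

  private
    n m : ℕ
    n = nV G
    m = nE G

  Vertex : Set
  Vertex = (Fin N ⊎ Fin N) × Fin n

  pattern hub i v  = inj₁ i , v
  pattern leaf j v = inj₂ j , v

  vertex : Vertex → Fin ((N + N) * n)
  vertex (x , v) = combine (join N N x) v

  fromVertex : Fin ((N + N) * n) → Vertex
  fromVertex t = let x , v = remQuot {N + N} n t in splitAt N x , v

  fromVertex-vertex : ∀ x → fromVertex (vertex x) ≡ x
  fromVertex-vertex (x , v) = trans (cong (λ (x , v) → splitAt N x , v) (remQuot-combine (join N N x) v))
                                    (cong (_, v) (splitAt-join N N x))

  vertex-fromVertex : ∀ t → vertex (fromVertex t) ≡ t
  vertex-fromVertex t = let x , v = remQuot {N + N} n t in
    trans (cong (λ x → combine x v) (join-splitAt N N x)) (combine-remQuot {N + N} n t)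

  vertex-injective : ∀ {x y} → vertex x ≡ vertex y → x ≡ y
  vertex-injective {x} {y} eq =
    trans (sym (fromVertex-vertex x)) (trans (cong fromVertex eq) (fromVertex-vertex y))

  Edge : Set
  Edge = Fin m ⊎ (Fin N × Fin N × Fin n)

  -- The order is the one in which the RAM prints the edges: the original ones, then the block edges
  -- with `i` outermost and `v` innermost.
  index : Edge → Fin (m + N * (N * n))
  index (inj₁ e)           = e ↑ˡ (N * (N * n))
  index (inj₂ (i , j , v)) = m ↑ʳ combine i (combine j v)

  fromIndex : Fin (m + N * (N * n)) → Edge
  fromIndex k = Sum.map₂ triple (splitAt m k)
    where
    triple : Fin (N * (N * n)) → Fin N × Fin N × Fin n
    triple l = let i , l′ = remQuot {N} (N * n) l in i , remQuot {N} n l′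

  fromIndex-index : ∀ x → fromIndex (index x) ≡ x
  fromIndex-index (inj₁ e) = cong (Sum.map₂ _) (splitAt-↑ˡ m e _)
  fromIndex-index (inj₂ (i , j , v)) =
    trans (cong (Sum.map₂ _) (splitAt-↑ʳ m _ (combine i (combine j v))))
      (cong inj₂ (trans (cong (λ (i , l) → i , remQuot {N} n l) (remQuot-combine i (combine j v)))
                        (cong (i ,_) (remQuot-combine j v))))

  index-fromIndex : ∀ k → index (fromIndex k) ≡ k
  index-fromIndex k with splitAt m k in eq
  ... | inj₁ e = splitAt⁻¹-↑ˡ eq
  ... | inj₂ l = let i , l′ = remQuot {N} (N * n) l in
    trans (cong (m ↑ʳ_) (trans (cong (combine i) (combine-remQuot {N} n l′))
                               (combine-remQuot {N} (N * n) l)))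
          (splitAt⁻¹-↑ʳ eq)

  position : Fin m → Fin N
  position e = inject≤ e (ℕ.<⇒≤ m<N)

  endpoints : Edge → Vertex × Vertex
  endpoints (inj₁ e)           = let u , v = ends G e in hub (position e) u , hub (position e) v
  endpoints (inj₂ (i , j , v)) = hub i v , leaf j v

  label : Edge → Fin (p + N * N)
  label (inj₁ e)           = χ e ↑ˡ (N * N)
  label (inj₂ (i , j , v)) = p ↑ʳ combine i j

  G♯ : Multigraph
  G♯ = record
    { nV = (N + N) * n ; nE = m + N * (N * n)
    ; ends = λ k → let x , y = endpoints (fromIndex k) in vertex x , vertex y }

  χ♯ : Labeling G♯ (p + N * N)
  χ♯ = label ∘ fromIndex

  -- Simplicity of the blown-up graph

  position-injective : ∀ {e f} → position e ≡ position f → e ≡ f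
  position-injective = inject≤-injective _ _ _ _

  -- Both ends of an original edge lie in hub layer `position e`, so its first end already
  -- determines `e`, even when the other edge is reversed. A block edge runs from a hub to a leaf,
  -- which rules out the mixed and the reversed cases.
  parallel⇒≡ : ∀ x y → endpoints x ≡ endpoints y ⊎ endpoints x ≡ swap (endpoints y) → x ≡ y
  parallel⇒≡ (inj₁ e) (inj₁ f) (inj₁ eq) =
    cong inj₁ (position-injective (inj₁-injective (,-injectiveˡ (,-injectiveˡ eq))))
  parallel⇒≡ (inj₁ e) (inj₁ f) (inj₂ eq) =
    cong inj₁ (position-injective (inj₁-injective (,-injectiveˡ (,-injectiveˡ eq))))
  parallel⇒≡ (inj₁ e) (inj₂ _) (inj₁ ())
  parallel⇒≡ (inj₁ e) (inj₂ _) (inj₂ ())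
  parallel⇒≡ (inj₂ _) (inj₁ f) (inj₁ ())
  parallel⇒≡ (inj₂ _) (inj₁ f) (inj₂ ())
  parallel⇒≡ (inj₂ _) (inj₂ _) (inj₁ refl) = refl
  parallel⇒≡ (inj₂ _) (inj₂ _) (inj₂ ())

  simple : Loopless G → Simple G♯
  simple loopless = (λ k → noLoop (fromIndex k) ∘ vertex-injective) , λ e f par →
    trans (sym (index-fromIndex e))
      (trans (cong index (parallel⇒≡ (fromIndex e) (fromIndex f) (Sum.map both both par)))
             (index-fromIndex f))
    where
    noLoop : ∀ x → proj₁ (endpoints x) ≢ proj₂ (endpoints x)
    noLoop (inj₁ e) eq = loopless e (,-injectiveʳ eq)
    noLoop (inj₂ _) ()
    both : ∀ {x y x′ y′} → (vertex x , vertex y) ≡ (vertex x′ , vertex y′) → (x , y) ≡ (x′ , y′)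
    both eq = cong₂ _,_ (vertex-injective (,-injectiveˡ eq)) (vertex-injective (,-injectiveʳ eq))

  -- Labels forced by a split block

  module _ (T : Subset (nV G♯)) where

    side : Vertex → Bool
    side x = lookup T (vertex x)

    SeparatesEdge : Edge → Set
    SeparatesEdge x = side (proj₁ (endpoints x)) ≢ side (proj₂ (endpoints x))

    ∈-cutLabels♯⁺ : ∀ x → SeparatesEdge x → label x ∈ image χ♯ (δ G♯ T)
    ∈-cutLabels♯⁺ x sep = subst (λ y → label y ∈ image χ♯ (δ G♯ T)) (fromIndex-index x)
      (∈-cutLabels⁺ G♯ T χ♯ (index x) (subst SeparatesEdge (sym (fromIndex-index x)) sep))

    -- The new label depends on `(i , j)` alone, so distinctness is asked of these two components
    -- and the vertex component is unconstrained.
    manyLabels : (f : Fin N → Fin N × Fin N × Fin n) →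
      (∀ k → SeparatesEdge (inj₂ (f k))) →
      (∀ k l → let i , j , _ = f k ; i′ , j′ , _ = f l in (i , j) ≡ (i′ , j′) → k ≡ l) →
      N ≤ cutLabels G♯ χ♯ T
    manyLabels f sep inj = subst (_≤ cutLabels G♯ χ♯ T) (∣⊤∣≡n N)
      (∣∣-mono-injection (λ k ℓ → label (inj₂ (f k)) ≡ ℓ)
        (λ {k} (_ : k ∈ ⊤) → _ , ∈-cutLabels♯⁺ (inj₂ (f k)) (sep k) , refl)
        λ {k} {l} eq eq′ → inj k l
          (uncurry (cong₂ _,_) (combine-injective _ _ _ _ (↑ʳ-injective p _ _ (trans eq (sym eq′))))))

    block-cut : ∀ v → N ≤ cutLabels G♯ χ♯ T ⊎ (∃[ b ] ∀ x → side (x , v) ≡ b)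
    block-cut v with cut-K (λ i → side (hub i v)) (λ j → side (leaf j v))
    ... | inj₁ (j , sep) =
      -- The leaves `j i` may coincide; the hub index alone keeps the labels distinct.
      inj₁ (manyLabels (λ i → i , j i , v) sep λ _ _ → ,-injectiveˡ)
    ... | inj₂ (inj₁ (i , sep)) =
      inj₁ (manyLabels (λ j → i , j , v) sep λ _ _ → ,-injectiveʳ)
    ... | inj₂ (inj₂ (b , hubs , leaves)) = inj₂ (b , Sum.[ hubs , leaves ])

  -- From cuts of `G♯` to cuts of `G`

  zeroth : Fin N
  zeroth = fromℕ< (ℕ.≤-<-trans z≤n m<N)

  module Restrict (T : Subset (nV G♯)) (unsplit : ∀ v → ∃[ b ] ∀ x → side T (x , v) ≡ b) where

    -- By `unsplit`, any other hub or leaf of each block would give the same set.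
    restrict : Subset n
    restrict = tabulate λ v → side T (hub zeroth v)

    lookup-restrict : ∀ x → lookup restrict (proj₂ x) ≡ side T x
    lookup-restrict (x , v) = trans (lookup∘tabulate _ v)
      (trans (proj₂ (unsplit v) (inj₁ zeroth)) (sym (proj₂ (unsplit v) x)))

    ∈-restrict⁺ : ∀ t → t ∈ T → proj₂ (fromVertex t) ∈ restrict
    ∈-restrict⁺ t t∈ = lookup⇒[]= _ _ (trans (lookup-restrict (fromVertex t))
      ([]=⇒lookup (subst (_∈ T) (sym (vertex-fromVertex t)) t∈)))

    ∈-restrict⁻ : ∀ t → proj₂ (fromVertex t) ∈ restrict → t ∈ T
    ∈-restrict⁻ t v∈ = subst (_∈ T) (vertex-fromVertex t)
      (lookup⇒[]= _ _ (trans (sym (lookup-restrict (fromVertex t))) ([]=⇒lookup v∈)))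

    restrict-proper : Proper T → Proper restrict
    restrict-proper ((t , t∈) , _ , s , _ , s∉) =
      (_ , ∈-restrict⁺ t t∈) , (λ _ → ∈⊤) , _ , ∈⊤ , s∉ ∘ ∈-restrict⁻ s

    -- A cut edge `e` of `G` becomes an edge between hubs on the same sides as its endpoints, so it
    -- is still cut, and `↑ˡ` keeps labels distinct.
    restrict-cutLabels : cutLabels G χ restrict ≤ cutLabels G♯ χ♯ T
    restrict-cutLabels = ∣∣-mono-injection (λ ℓ ℓ♯ → ℓ ↑ˡ (N * N) ≡ ℓ♯) lift
      λ {ℓ} {ℓ′} eq eq′ → ↑ˡ-injective (N * N) ℓ ℓ′ (trans eq (sym eq′))
      where
      lift : ∀ {ℓ} → ℓ ∈ image χ (δ G restrict) →
             ∃[ ℓ♯ ] ℓ♯ ∈ image χ♯ (δ G♯ T) × ℓ ↑ˡ (N * N) ≡ ℓ♯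
      lift ℓ∈ with ∈-cutLabels⁻ G restrict χ ℓ∈
      ... | e , sep , refl = _ , ∈-cutLabels♯⁺ T (inj₁ e) sep♯ , refl
        where
        sep♯ : SeparatesEdge T (inj₁ e)
        sep♯ eq = let x , y = endpoints (inj₁ e) in
          sep (trans (lookup-restrict x) (trans eq (sym (lookup-restrict y))))

  -- The case split is on the number of labels rather than on blocks: fewer than `N` labels leave
  -- only the second alternative of `block-cut`, for all `v` at once. With at least `N` labels any
  -- proper set will do, because no cut of `G` has more than `m`.
  contract : 2 ≤ n → ∀ T → Proper T →
             ∃[ S ] Proper S × cutLabels G χ S ≤ cutLabels G♯ χ♯ T
  contract n≥2 T proper with N ℕ.≤? cutLabels G♯ χ♯ T
  ... | yes N≤ = _ , firstVertex-proper n≥2 ,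
                 ℕ.≤-trans (ℕ.≤-trans (cutLabels≤nE G _ χ) (ℕ.<⇒≤ m<N)) N≤
  ... | no N≰ = restrict , restrict-proper proper , restrict-cutLabels
    where open Restrict T (λ v → Sum.[ (λ N≤ → contradiction N≤ N≰) , id ]′ (block-cut T v))

  -- From cuts of `G` to cuts of `G♯`, and equality of the optima

  blow : Subset n → Subset (nV G♯)
  blow S = tabulate (lookup S ∘ proj₂ ∘ fromVertex)

  side-blow : ∀ S x → side (blow S) x ≡ lookup S (proj₂ x)
  side-blow S x = trans (lookup∘tabulate _ (vertex x)) (cong (lookup S ∘ proj₂) (fromVertex-vertex x))

  blow-proper : ∀ S → Proper S → Proper (blow S)
  blow-proper S ((u , u∈) , _ , v , _ , v∉) =
    (_ , lookup⇒[]= _ _ (trans (side-blow S (hub zeroth u)) ([]=⇒lookup u∈))) ,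
    (λ _ → ∈⊤) , _ , ∈⊤ ,
    λ v∈ → v∉ (lookup⇒[]= v S (trans (sym (side-blow S (hub zeroth v))) ([]=⇒lookup v∈)))

  -- Both ends of a block edge lie over the same vertex, hence on the same side; only original edges
  -- can be cut.
  blow-cutLabels : ∀ S → cutLabels G♯ χ♯ (blow S) ≤ cutLabels G χ S
  blow-cutLabels S = ∣∣-mono-injection (λ ℓ♯ ℓ → ℓ ↑ˡ (N * N) ≡ ℓ♯) unlift λ { refl refl → refl }
    where
    original : ∀ x → SeparatesEdge (blow S) x →
               ∃[ ℓ ] ℓ ∈ image χ (δ G S) × ℓ ↑ˡ (N * N) ≡ label x
    original x@(inj₁ e) sep = χ e , ∈-cutLabels⁺ G S χ e (λ eq → let y , z = endpoints x in
      sep (trans (side-blow S y) (trans eq (sym (side-blow S z))))) , refl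
    original (inj₂ (i , j , v)) sep =
      contradiction (trans (side-blow S (hub i v)) (sym (side-blow S (leaf j v)))) sep
    unlift : ∀ {ℓ♯} → ℓ♯ ∈ image χ♯ (δ G♯ (blow S)) →
             ∃[ ℓ ] ℓ ∈ image χ (δ G S) × ℓ ↑ˡ (N * N) ≡ ℓ♯
    unlift ℓ∈ with ∈-cutLabels⁻ G♯ (blow S) χ♯ ℓ∈
    ... | k , sep , refl = original (fromIndex k) sep

  yes⇔ : 2 ≤ n → ∀ b → (∃[ S ] Proper S × cutLabels G χ S ≤ b) ⇔
                        (∃[ T ] Proper T × cutLabels G♯ χ♯ T ≤ b)
  yes⇔ n≥2 b = mk⇔
    (λ (S , proper , ≤b) → blow S , blow-proper S proper , ℕ.≤-trans (blow-cutLabels S) ≤b)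
    (λ (T , proper , ≤b) → let S , proper′ , ≤T = contract n≥2 T proper in
                           S , proper′ , ℕ.≤-trans ≤T ≤b)

  -- A minimiser in either graph is carried to the other by `blow` or `contract`, without raising
  -- its value.
  OPT♯≡OPT : (n≥2 : 2 ≤ n) (n♯≥2 : 2 ≤ nV G♯) → OPT G♯ n♯≥2 χ♯ ≡ OPT G n≥2 χ
  OPT♯≡OPT n≥2 n♯≥2 = ℕ.≤-antisym
    (let S , proper , eq = OPT-attained G n≥2 χ in
     ℕ.≤-trans (OPT-minimal G♯ n♯≥2 χ♯ (blow S) (blow-proper S proper))
               (ℕ.≤-trans (blow-cutLabels S) (ℕ.≤-reflexive eq)))
    (let T , proper , eq = OPT-attained G♯ n♯≥2 χ♯
         S , proper′ , ≤T = contract n≥2 T proper in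
     ℕ.≤-trans (OPT-minimal G n≥2 χ S proper′) (ℕ.≤-trans ≤T (ℕ.≤-reflexive eq)))

-- Hoare-style rules for the RAM

-- At `suc n` this unfolds to `f zero ++ gather (f ∘ suc)`, the shape produced by one loop round
-- followed by the rest.
gather : ∀ {n} → (Fin n → List ℕ) → List ℕ
gather f = List.concat (List.tabulate f)

gather-[] : ∀ n → gather {n} (λ _ → []) ≡ []
gather-[] zero    = refl
gather-[] (suc n) = gather-[] n

module _ {k : ℕ} where

  -- Memories are functions, so they are compared pointwise, and only on the first `k` cells.
  record Tracks (X : ℕ → ℕ) (R : Vec ℕ k) : Set where
    constructor tracks
    field
      cell : ∀ i → X (toℕ i) ≡ lookup R i

  open Tracks

  ≔-hit : ∀ X i x → (X [ i ≔ x ]) i ≡ x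
  ≔-hit X i x with i ≡ᵇ i | ℕ.≡⇒≡ᵇ i i refl
  ... | true | _ = refl

  ≔-miss : ∀ X {i j} x → i ≢ j → (X [ i ≔ x ]) j ≡ X j
  ≔-miss X {i} {j} x i≢j with i ≡ᵇ j in eq
  ... | false = refl
  ... | true  = contradiction (ℕ.≡ᵇ⇒≡ i j (subst T (sym eq) tt)) i≢j

  tracks-≔ : ∀ {X R} i {x y} → Tracks X R → x ≡ y → Tracks (X [ toℕ i ≔ x ]) (R [ i ]≔ y)
  cell (tracks-≔ {X} {R} i {x} X∼R refl) j with i Fin.≟ j
  ... | yes refl = trans (≔-hit X (toℕ i) x) (sym (lookup∘update i R x))
  ... | no i≢j   = trans (≔-miss X x (i≢j ∘ Fin.toℕ-injective))
                         (trans (cell X∼R j) (sym (lookup∘update′ (i≢j ∘ sym) R x)))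

  tracks-junk : ∀ {X R x} → Tracks X R → Tracks (X [ k ≔ x ]) R
  cell (tracks-junk {X} {x = x} X∼R) i = trans (≔-miss X x (ℕ.>⇒≢ (Fin.toℕ<n i))) (cell X∼R i)

  -- Quantifying over the unread input `xs` and the earlier output `ys` is a frame rule: it lets
  -- runs be concatenated. The time `t` is exact.
  record Runs (P : Program) (R : Vec ℕ k) (ws : List ℕ) (t : ℕ) (R′ : Vec ℕ k) (zs : List ℕ) : Set where
    constructor runs
    field
      run : ∀ X xs ys → Tracks X R →
            ∃[ X′ ] Tracks X′ R′ × ⟨ P , ⟪ X , ws ++ xs , ys ⟫ ⟩⇓[ t ] ⟪ X′ , xs , ys ++ zs ⟫

  open Runs public

  private variable
    P Q : Program
    R R′ R″ : Vec ℕ k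
    ws ws′ zs zs′ : List ℕ
    t t′ : ℕ

  -- Shared by sequencing and by a loop round, which differ only in the final evaluation rule.
  through : Runs P R ws t R′ zs → Runs Q R′ ws′ t′ R″ zs′ → ∀ X xs ys → Tracks X R →
            ∃[ X″ ] Tracks X″ R″ × ∃[ s ]
              ⟨ P , ⟪ X , (ws ++ ws′) ++ xs , ys ⟫ ⟩⇓[ t ] s ×
              ⟨ Q , s ⟩⇓[ t′ ] ⟪ X″ , xs , ys ++ zs ++ zs′ ⟫
  through {ws = ws} {zs = zs} {ws′ = ws′} {zs′ = zs′} p q X xs ys X∼R
    with run p X (ws′ ++ xs) ys X∼R
  ... | X′ , X′∼R′ , p⇓ with run q X′ xs (ys ++ zs) X′∼R′
  ...   | X″ , X″∼R″ , q⇓ = X″ , X″∼R″ , _ ,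
    subst (λ is → ⟨ _ , ⟪ X , is , ys ⟫ ⟩⇓[ _ ] _) (sym (List.++-assoc ws ws′ xs)) p⇓ ,
    subst (λ os → ⟨ _ , _ ⟩⇓[ _ ] ⟪ X″ , xs , os ⟫) (List.++-assoc ys zs zs′) q⇓

  infixr 5 _⨾ʳ_

  _⨾ʳ_ : Runs P R ws t R′ zs → Runs Q R′ ws′ t′ R″ zs′ →
         Runs (P ⨾ Q) R (ws ++ ws′) (t + t′) R″ (zs ++ zs′)
  run (p ⨾ʳ q) X xs ys X∼R with through p q X xs ys X∼R
  ... | X″ , X″∼R″ , _ , p⇓ , q⇓ = X″ , X″∼R″ , ⨾⇓ p⇓ q⇓

  runs-silently : (∀ X → Tracks X R →
                   ∃[ X′ ] Tracks X′ R′ × (∀ xs ys → ⟨ P , ⟪ X , xs , ys ⟫ ⟩⇓[ t ] ⟪ X′ , xs , ys ⟫)) →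
                  Runs P R [] t R′ []
  run (runs-silently f) X xs ys X∼R with f X X∼R
  ... | X′ , X′∼R′ , p⇓ = X′ , X′∼R′ ,
    subst (λ os → ⟨ _ , ⟪ X , xs , ys ⟫ ⟩⇓[ _ ] ⟪ X′ , xs , os ⟫) (sym (List.++-identityʳ ys)) (p⇓ xs ys)

  -- Symbolic execution of straight-line code

  data Instr : Set where
    set          : Fin k → ℕ → Instr
    plus minus   : Fin k → Fin k → Fin k → Instr
    input output : Fin k → Instr

  program : Instr → Program
  program (set i c)     = const (toℕ i) c
  program (plus i j l)  = add (toℕ i) (toℕ j) (toℕ l)
  program (minus i j l) = sub (toℕ i) (toℕ j) (toℕ l)
  program (input i)     = read (toℕ i)
  program (output i)    = print (toℕ i)

  -- The instruction ending a block overwrites a cell that is not tracked.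
  block : List Instr → Program
  block []       = const k 0
  block (i ∷ is) = program i ⨾ block is

  inputs : List Instr → ℕ
  inputs []             = 0
  inputs (input _ ∷ is) = suc (inputs is)
  inputs (_ ∷ is)       = inputs is

  -- For a concrete instruction list, `final` and `outputs` reduce completely, so the specification
  -- of a block needs no equational reasoning.
  final : ∀ is → Vec ℕ k → Vec ℕ (inputs is) → Vec ℕ k
  final []                 R ws       = R
  final (set i c ∷ is)     R ws       = final is (R [ i ]≔ c) ws
  final (plus i j l ∷ is)  R ws       = final is (R [ i ]≔ (lookup R j + lookup R l)) ws
  final (minus i j l ∷ is) R ws       = final is (R [ i ]≔ (lookup R j ∸ lookup R l)) ws
  final (input i ∷ is)     R (w ∷ ws) = final is (R [ i ]≔ w) ws
  final (output i ∷ is)    R ws       = final is R ws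

  outputs : ∀ is → Vec ℕ k → Vec ℕ (inputs is) → List ℕ
  outputs []                 R ws       = []
  outputs (set i c ∷ is)     R ws       = outputs is (R [ i ]≔ c) ws
  outputs (plus i j l ∷ is)  R ws       = outputs is (R [ i ]≔ (lookup R j + lookup R l)) ws
  outputs (minus i j l ∷ is) R ws       = outputs is (R [ i ]≔ (lookup R j ∸ lookup R l)) ws
  outputs (input i ∷ is)     R (w ∷ ws) = outputs is (R [ i ]≔ w) ws
  outputs (output i ∷ is)    R ws       = lookup R i ∷ outputs is R ws

  block-runs : ∀ is R ws →
    Runs (block is) R (toList ws) (suc (List.length is)) (final is R ws) (outputs is R ws)
  block-runs [] R [] = runs-silently λ X X∼R → _ , tracks-junk X∼R , λ _ _ → const⇓
  block-runs (set i c ∷ is) R ws =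
    (runs-silently λ X X∼R → _ , tracks-≔ i X∼R refl , λ _ _ → const⇓) ⨾ʳ block-runs is _ ws
  block-runs (plus i j l ∷ is) R ws =
    (runs-silently λ X X∼R → _ , tracks-≔ i X∼R (cong₂ _+_ (cell X∼R j) (cell X∼R l)) , λ _ _ → add⇓)
    ⨾ʳ block-runs is _ ws
  block-runs (minus i j l ∷ is) R ws =
    (runs-silently λ X X∼R → _ , tracks-≔ i X∼R (cong₂ _∸_ (cell X∼R j) (cell X∼R l)) , λ _ _ → sub⇓)
    ⨾ʳ block-runs is _ ws
  block-runs (input i ∷ is) R (w ∷ ws) = input-runs ⨾ʳ block-runs is _ ws
    where
    input-runs : Runs (read (toℕ i)) R (w ∷ []) 1 (R [ i ]≔ w) []
    run input-runs X xs ys X∼R = _ , tracks-≔ i X∼R refl ,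
      subst (λ os → ⟨ _ , ⟪ X , w ∷ xs , ys ⟫ ⟩⇓[ 1 ] ⟪ _ , xs , os ⟫) (sym (List.++-identityʳ ys)) read⇓
  block-runs (output i ∷ is) R ws = output-runs ⨾ʳ block-runs is _ ws
    where
    output-runs : Runs (print (toℕ i)) R [] 1 R (lookup R i ∷ [])
    run output-runs X xs ys X∼R = X , X∼R ,
      subst (λ z → ⟨ _ , ⟪ X , xs , ys ⟫ ⟩⇓[ 1 ] ⟪ X , xs , ys ++ z ∷ [] ⟫) (cell X∼R i) print⇓

  runs-via : ws ≡ ws′ → zs ≡ zs′ → Runs P R ws t R′ zs → Runs P R ws′ t R′ zs′
  runs-via refl refl p = p

  after : ∀ {s s′} → t ≡ t′ → ⟨ P , s ⟩⇓[ t ] s′ → ⟨ P , s ⟩⇓[ t′ ] s′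
  after refl p = p

  -- R r j are the registers with r rounds to go and j rounds done.
  repeat : ∀ {P t} c (R : ℕ → ℕ → Vec ℕ k) → (∀ r j → lookup (R r j) c ≡ r) →
    ∀ n {ws zs : Fin n → List ℕ} →
    (∀ r e → Runs P (R (suc r) (toℕ e)) (ws e) t (R r (suc (toℕ e))) (zs e)) →
    Runs (while (toℕ c) P) (R n 0) (gather ws) (suc (n * suc t)) (R 0 n) (gather zs)
  repeat c R count zero body =
    runs-silently λ X X∼R → X , X∼R , λ _ _ → stop⇓ (trans (cell X∼R c) (count 0 0))
  run (repeat {P} {t} c R count (suc n) {ws} {zs} body) X xs ys X∼R
    with through (body n zero)
                 -- The family is shifted by one, so that the remaining rounds again start with none
                 -- done.
                 (repeat c (λ r j → R r (suc j)) (λ r j → count r (suc j)) n (λ r e → body r (suc e)))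
                 X xs ys X∼R
  ... | X″ , X″∼R″ , _ , p⇓ , q⇓ = X″ , X″∼R″ ,
    -- A round costs its body and one test; the extra `suc` is the failing last test, moved past
    -- `t`.
    after (cong suc (ℕ.+-suc t (n * suc t)))
      (loop⇓ (λ eq → ℕ.1+n≢0 (trans (sym (trans (cell X∼R c) (count (suc n) 0))) eq)) p⇓ q⇓)

  repeat-noInput : ∀ {P t} c (R : ℕ → ℕ → Vec ℕ k) → (∀ r j → lookup (R r j) c ≡ r) →
    ∀ n {zs : Fin n → List ℕ} →
    (∀ r e → Runs P (R (suc r) (toℕ e)) [] t (R r (suc (toℕ e))) (zs e)) →
    Runs (while (toℕ c) P) (R n 0) [] (suc (n * suc t)) (R 0 n) (gather zs)
  repeat-noInput c R count n body =
    runs-via (gather-[] n) refl (repeat c R count n body)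

  repeat-silent : ∀ {P t} c (R : ℕ → ℕ → Vec ℕ k) → (∀ r j → lookup (R r j) c ≡ r) → ∀ n →
    (∀ r j → Runs P (R (suc r) j) [] t (R r (suc j)) []) →
    Runs (while (toℕ c) P) (R n 0) [] (suc (n * suc t)) (R 0 n) []
  repeat-silent c R count n body =
    runs-via refl (gather-[] n) (repeat-noInput c R count n λ r e → body r (toℕ e))

-- The program

Register : Set
Register = Fin 16

rV rE rP rB r1 rN rI rJ rK rHub rLeaf rLabel rX rY rZ rNV : Register
rV = # 0
rE = # 1
rP = # 2
rB = # 3
r1 = # 4
rN = # 5
rI = # 6
rJ = # 7
rK = # 8
rHub = # 9
rLeaf = # 10
rLabel = # 11
rX = # 12
rY = # 13
rZ = # 14
rNV = # 15

while′ : Register → Program → Program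
while′ r = while (toℕ r)

-- Hub i and leaf j of vertex v are numbered i * |V| + v and (j + N) * |V| + v,
-- so rHub and rLeaf hold the multiple of |V|, which grows by one addition
-- per round.  Until header, rNV, rX and rY build up N |V|, N² and N² |V|.
-- plus r rZ s serves as a copy, rZ being 0 wherever it is used so.
start squares cubes header originals rewind : List (Instr {16})
start     = input rV ∷ input rE ∷ input rP ∷ input rB ∷ set r1 1 ∷ plus rN r1 rE ∷ plus rI rZ rN ∷ []
squares   = plus rNV rV rNV ∷ plus rX rN rX ∷ minus rI rI r1 ∷ []
cubes     = plus rY rNV rY ∷ minus rI rI r1 ∷ []
header    = plus rHub rNV rNV ∷ output rHub ∷ plus rHub rE rY ∷ output rHub ∷
            plus rHub rP rX ∷ output rHub ∷ output rB ∷
            set rHub 0 ∷ set rX 0 ∷ set rY 0 ∷ plus rI rZ rE ∷ []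
originals = input rX ∷ input rY ∷ input rZ ∷ plus rX rHub rX ∷ plus rY rHub rY ∷
            output rX ∷ output rY ∷ output rZ ∷
            plus rHub rV rHub ∷ minus rI rI r1 ∷ set rX 0 ∷ set rY 0 ∷ set rZ 0 ∷ []
rewind    = set rHub 0 ∷ plus rI rZ rN ∷ []

hubStart hubEnd leafStart leafEnd copy : List (Instr {16})
hubStart  = plus rJ rZ rN ∷ plus rLeaf rZ rNV ∷ []
hubEnd    = set rLeaf 0 ∷ plus rHub rV rHub ∷ minus rI rI r1 ∷ []
leafStart = plus rK rZ rV ∷ plus rX rZ rHub ∷ plus rY rZ rLeaf ∷ plus rZ rP rLabel ∷ []
leafEnd   = set rX 0 ∷ set rY 0 ∷ set rZ 0 ∷
            plus rLeaf rV rLeaf ∷ plus rLabel r1 rLabel ∷ minus rJ rJ r1 ∷ []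
copy      = output rX ∷ output rY ∷ output rZ ∷ plus rX r1 rX ∷ plus rY r1 rY ∷ minus rK rK r1 ∷ []

leafRound hubRound blowup : Program
leafRound = block leafStart ⨾ while′ rK (block copy) ⨾ block leafEnd
hubRound  = block hubStart ⨾ while′ rJ leafRound ⨾ block hubEnd
blowup    = block start ⨾ while′ rI (block squares) ⨾ block (plus rI rZ rN ∷ []) ⨾
            while′ rI (block cubes) ⨾ block header ⨾ while′ rI (block originals) ⨾
            block rewind ⨾ while′ rI hubRound

-- The nesting copies that of `blowup`, so the exact time matches by computation. A block costs one
-- more than its length, and a loop body one more again for the test.
blowupTime : ℕ → ℕ → ℕ → ℕ
blowupTime n m N =
  8 + (suc (N * 5) + (2 + (suc (N * 4) + (12 + (suc (m * 15) +
  (3 + suc (N * suc (3 + (suc (N * suc (5 + (suc (n * 8) + 7))) + 4)))))))))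

-- Loop invariants of the program

module _ (n m p b : ℕ) where

  private
    N : ℕ
    N = suc m

  regs : (I J K hub leaf label x y z NV : ℕ) → Vec ℕ 16
  regs I J K hub leaf label x y z NV =
    n ∷ m ∷ p ∷ b ∷ 1 ∷ N ∷ I ∷ J ∷ K ∷ hub ∷ leaf ∷ label ∷ x ∷ y ∷ z ∷ NV ∷ []

  -- The growing counter is the left summand, so that `suc v + i * n` reduces to `1 + (v + i * n)`,
  -- as `copy` computes it; `row-gadget` commutes the sums afterwards.
  gadgetRows : ℕ → ℕ → Fin n → List ℕ
  gadgetRows i j v = toℕ v + i * n ∷ toℕ v + (j + N) * n ∷ p + (j + i * N) ∷ []

  -- The invariant advances by computation: `(suc j + N) * n` unfolds to `n + (j + N) * n`, and
  -- `suc j + i * N` to `1 + (j + i * N)`, with the operands in the order used by `leafEnd`.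
  leafRound-runs : ∀ r s i j → Runs leafRound
    (regs s (suc r) 0 (i * n) ((j + N) * n) (j + i * N) 0 0 0 (N * n)) [] (5 + (suc (n * 8) + 7))
    (regs s r 0 (i * n) ((suc j + N) * n) (suc j + i * N) 0 0 0 (N * n)) (gather (gadgetRows i j))
  leafRound-runs r s i j = runs-via refl (List.++-identityʳ _)
    (block-runs leafStart _ [] ⨾ʳ
     repeat-noInput rK (λ r′ v → regs s (suc r) r′ (i * n) ((j + N) * n) (j + i * N)
                                   (v + i * n) (v + (j + N) * n) (p + (j + i * N)) (N * n))
       (λ _ _ → refl) n (λ r′ v → block-runs copy _ []) ⨾ʳ
     block-runs leafEnd _ [])

  hubRound-runs : ∀ r i → Runs hubRound
    (regs (suc r) 0 0 (i * n) 0 (i * N) 0 0 0 (N * n)) []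
    (3 + (suc (N * suc (5 + (suc (n * 8) + 7))) + 4))
    (regs r 0 0 (suc i * n) 0 (suc i * N) 0 0 0 (N * n))
    (gather {N} λ j → gather (gadgetRows i (toℕ j)))
  hubRound-runs r i = runs-via refl (List.++-identityʳ _)
    (block-runs hubStart _ [] ⨾ʳ
     repeat-noInput rJ (λ s j → regs (suc r) s 0 (i * n) ((j + N) * n) (j + i * N) 0 0 0 (N * n))
       (λ _ _ → refl) N (λ s j → leafRound-runs s (suc r) i (toℕ j)) ⨾ʳ
     block-runs hubEnd _ [])

  module _ (u v ℓ : Fin m → ℕ) where

    blowup-runs : Runs blowup (Vec.replicate 16 0)
      (n ∷ m ∷ p ∷ b ∷ gather λ e → u e ∷ v e ∷ ℓ e ∷ [])
      (blowupTime n m N)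
      (regs 0 0 0 (N * n) 0 (N * N) 0 0 0 (N * n))
      (N * n + N * n ∷ m + N * (N * n) ∷ p + N * N ∷ b ∷
       (gather λ e → toℕ e * n + u e ∷ toℕ e * n + v e ∷ ℓ e ∷ []) ++
       (gather {N} λ i → gather {N} λ j → gather (gadgetRows (toℕ i) (toℕ j))))
    blowup-runs = runs-via (cong (λ ws → n ∷ m ∷ p ∷ b ∷ ws) (List.++-identityʳ _)) refl
      (block-runs start _ (n ∷ m ∷ p ∷ b ∷ []) ⨾ʳ
       repeat-silent rI (λ r j → regs r 0 0 0 0 0 (j * N) 0 0 (j * n))
         (λ _ _ → refl) N (λ r j → block-runs squares _ []) ⨾ʳ
       block-runs (plus rI rZ rN ∷ []) _ [] ⨾ʳ
       repeat-silent rI (λ r j → regs r 0 0 0 0 0 (N * N) (j * (N * n)) 0 (N * n))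
         (λ _ _ → refl) N (λ r j → block-runs cubes _ []) ⨾ʳ
       block-runs header _ [] ⨾ʳ
       repeat rI (λ r j → regs r 0 0 (j * n) 0 0 0 0 0 (N * n))
         (λ _ _ → refl) m (λ r e → block-runs originals _ (u e ∷ v e ∷ ℓ e ∷ [])) ⨾ʳ
       block-runs rewind _ [] ⨾ʳ
       repeat-noInput rI (λ r i → regs r 0 0 (i * n) 0 (i * N) 0 0 0 (N * n))
         (λ _ _ → refl) N (λ r i → hubRound-runs r (toℕ i)))

-- The output is the encoding of the blown-up instance

gather-cong : ∀ {n} {f g : Fin n → List ℕ} → f ≗ g → gather f ≡ gather g
gather-cong f≗g = cong List.concat (List.tabulate-cong f≗g)

gather-+ : ∀ m {n} (f : Fin (m + n) → List ℕ) →
           gather f ≡ gather (f ∘ (_↑ˡ n)) ++ gather (f ∘ (m ↑ʳ_))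
gather-+ zero    f = refl
gather-+ (suc m) f = trans (cong (f zero ++_) (gather-+ m (f ∘ suc))) (sym (List.++-assoc (f zero) _ _))

-- `combine` is lexicographic with the first coordinate outermost; this turns a flat enumeration
-- into nested loops.
gather-* : ∀ m n (f : Fin (m * n) → List ℕ) →
           gather f ≡ gather λ i → gather λ j → f (combine {m} {n} i j)
gather-* zero    n f = refl
gather-* (suc m) n f =
  trans (gather-+ n f) (cong (gather (f ∘ (_↑ˡ (m * n))) ++_) (gather-* m n (f ∘ (n ↑ʳ_))))

concatMap-allFin : ∀ {n} (f : Fin n → List ℕ) → concatMap f (allFin n) ≡ gather f
concatMap-allFin f = cong List.concat (List.map-tabulate id f)

module Correctness (I : Instance) where

  private
    n m N : ℕ
    n = nV (G I)
    m = nE (G I)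
    N = suc m

  open Blowup (G I) (χ I) N (ℕ.n<1+n m) public

  I♯ : Instance
  I♯ = record
    { G = G♯ ; p = p I + N * N ; χ = χ♯ ; b = b I ; b≤p = ℕ.≤-trans (b≤p I) (ℕ.m≤m+n (p I) (N * N)) }

  toℕ-hub : ∀ i v → toℕ (vertex (hub i v)) ≡ toℕ i * n + toℕ v
  toℕ-hub i v = trans (Fin.toℕ-combine (i ↑ˡ N) v)
    (cong (_+ toℕ v) (trans (ℕ.*-comm n _) (cong (_* n) (Fin.toℕ-↑ˡ i N))))

  toℕ-leaf : ∀ j v → toℕ (vertex (leaf j v)) ≡ (toℕ j + N) * n + toℕ v
  toℕ-leaf j v = trans (Fin.toℕ-combine (N ↑ʳ j) v)
    (cong (_+ toℕ v) (trans (ℕ.*-comm n _)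
      (cong (_* n) (trans (Fin.toℕ-↑ʳ N j) (ℕ.+-comm N (toℕ j))))))

  toℕ-new-label : ∀ i j v → toℕ (label (inj₂ (i , j , v))) ≡ p I + (toℕ j + toℕ i * N)
  toℕ-new-label i j v = trans (Fin.toℕ-↑ʳ (p I) (combine i j)) (cong (p I +_)
    (trans (Fin.toℕ-combine i j) (trans (ℕ.+-comm (N * toℕ i) (toℕ j))
      (cong (toℕ j +_) (ℕ.*-comm N (toℕ i))))))

  row : Edge → List ℕ
  row x = let y , z = endpoints x in toℕ (vertex y) ∷ toℕ (vertex z) ∷ toℕ (label x) ∷ []

  row₃ : ∀ {x x′ y y′ z z′ : ℕ} → x ≡ x′ → y ≡ y′ → z ≡ z′ →
         _≡_ {A = List ℕ} (x ∷ y ∷ z ∷ []) (x′ ∷ y′ ∷ z′ ∷ [])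
  row₃ refl refl refl = refl

  source target label₀ : Fin m → ℕ
  source e = toℕ (proj₁ (ends (G I) e))
  target e = toℕ (proj₂ (ends (G I) e))
  label₀ e = toℕ (χ I e)

  row-original : ∀ e → row (fromIndex (index (inj₁ e))) ≡
                       toℕ e * n + source e ∷ toℕ e * n + target e ∷ label₀ e ∷ []
  row-original e = trans (cong row (fromIndex-index (inj₁ e)))
    (row₃ (at (proj₁ (ends (G I) e))) (at (proj₂ (ends (G I) e))) (Fin.toℕ-↑ˡ (χ I e) (N * N)))
    where
    at : ∀ v → toℕ (vertex (hub (position e) v)) ≡ toℕ e * n + toℕ v
    at v = trans (toℕ-hub (position e) v) (cong (λ i → i * n + toℕ v) (Fin.toℕ-inject≤ e _))

  row-gadget : ∀ i j v → row (fromIndex (index (inj₂ (i , j , v)))) ≡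
                         gadgetRows n m (p I) (b I) (toℕ i) (toℕ j) v
  row-gadget i j v = trans (cong row (fromIndex-index (inj₂ (i , j , v))))
    (row₃ (trans (toℕ-hub i v) (ℕ.+-comm _ (toℕ v))) (trans (toℕ-leaf j v) (ℕ.+-comm _ (toℕ v)))
          (toℕ-new-label i j v))

  encode-I : n ∷ m ∷ p I ∷ b I ∷ (gather λ e → source e ∷ target e ∷ label₀ e ∷ []) ≡ encode I
  encode-I = cong (λ es → n ∷ m ∷ p I ∷ b I ∷ es)
    (sym (concatMap-allFin λ e → source e ∷ target e ∷ label₀ e ∷ []))

  encode-I♯ : N * n + N * n ∷ m + N * (N * n) ∷ p I + N * N ∷ b I ∷
              (gather λ e → toℕ e * n + source e ∷ toℕ e * n + target e ∷ label₀ e ∷ []) ++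
              (gather {N} λ i → gather {N} λ j → gather (gadgetRows n m (p I) (b I) (toℕ i) (toℕ j)))
              ≡ encode I♯
  encode-I♯ = sym (cong₂ (λ nV es → nV ∷ m + N * (N * n) ∷ p I + N * N ∷ b I ∷ es)
    (ℕ.*-distribʳ-+ n N N)
    (trans (concatMap-allFin (row ∘ fromIndex)) (trans (gather-+ m (row ∘ fromIndex))
      (cong₂ _++_ (gather-cong row-original)
        (trans (gather-* N (N * n) (λ k → row (fromIndex (m ↑ʳ k)))) (gather-cong λ i →
          trans (gather-* N n (λ k → row (fromIndex (m ↑ʳ combine i k)))) (gather-cong λ j →
            gather-cong (row-gadget i j))))))))

  blowup-constructs : ∃[ s ]
    ⟨ blowup , initial (encode I) ⟩⇓[ blowupTime n m N ] s × out s ≡ encode I♯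
  blowup-constructs with
    run (blowup-runs n m (p I) (b I) source target label₀) (λ _ → 0) [] []
        (tracks λ i → sym (lookup-replicate i 0))
  ... | _ , _ , p⇓ = _ ,
    on-input (trans (List.++-identityʳ _) encode-I) p⇓ ,
    encode-I♯
    where
    on-input : ∀ {P ws ws′ t s} → ws ≡ ws′ →
               ⟨ P , initial ws ⟩⇓[ t ] s → ⟨ P , initial ws′ ⟩⇓[ t ] s
    on-input refl p = p

-- Polynomial bounds

-- In the naturals lower powers of `s` are at most its cube, even at zero. The coefficient sum is
-- used twice to reach the form `c * s ^ k + c`.
cubic-bound : ∀ a b c d s → a * s ^ 3 + b * s ^ 2 + c * s + d ≤ (a + b + c + d) * s ^ 3 + (a + b + c + d)
cubic-bound a b c d s = begin
  a * s ^ 3 + b * s ^ 2 + c * s + d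
    ≤⟨ ℕ.+-mono-≤ (ℕ.+-mono-≤ (ℕ.+-monoʳ-≤ (a * s ^ 3) (ℕ.*-monoʳ-≤ b (s²≤s³ s))) (ℕ.*-monoʳ-≤ c (s≤s³ s)))
                  (ℕ.m≤n+m d (a + b + c)) ⟩
  a * s ^ 3 + b * s ^ 3 + c * s ^ 3 + (a + b + c + d)
    ≡⟨ cong (_+ (a + b + c + d)) (sym (trans (ℕ.*-distribʳ-+ (s ^ 3) (a + b) c)
                                            (cong (_+ c * s ^ 3) (ℕ.*-distribʳ-+ (s ^ 3) a b)))) ⟩
  (a + b + c) * s ^ 3 + (a + b + c + d)
    ≤⟨ ℕ.+-monoˡ-≤ (a + b + c + d) (ℕ.*-monoˡ-≤ (s ^ 3) (ℕ.m≤m+n (a + b + c) d)) ⟩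
  (a + b + c + d) * s ^ 3 + (a + b + c + d) ∎
  where
  open ℕ.≤-Reasoning
  s²≤s³ : ∀ s → s ^ 2 ≤ s ^ 3
  s²≤s³ zero    = z≤n
  s²≤s³ (suc s) = ℕ.m≤m+n _ _
  s≤s³ : ∀ s → s ≤ s ^ 3
  s≤s³ zero    = z≤n
  s≤s³ (suc s) = ℕ.m≤m*n (suc s) (suc s ^ 2) ⦃ ℕ.m^n≢0 (suc s) 2 ⦄

blowupTime-mono : ∀ {n m N n′ m′ N′} → n ≤ n′ → m ≤ m′ → N ≤ N′ →
                  blowupTime n m N ≤ blowupTime n′ m′ N′
blowupTime-mono n≤ m≤ N≤ =
  ℕ.+-monoʳ-≤ 8 (ℕ.+-mono-≤ (s≤s (ℕ.*-monoˡ-≤ 5 N≤)) (ℕ.+-monoʳ-≤ 2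
  (ℕ.+-mono-≤ (s≤s (ℕ.*-monoˡ-≤ 4 N≤)) (ℕ.+-monoʳ-≤ 12 (ℕ.+-mono-≤ (s≤s (ℕ.*-monoˡ-≤ 15 m≤))
  (ℕ.+-monoʳ-≤ 3 (s≤s (ℕ.*-mono-≤ N≤ (s≤s (ℕ.+-monoʳ-≤ 3 (ℕ.+-monoˡ-≤ 4
  (s≤s (ℕ.*-mono-≤ N≤ (s≤s (ℕ.+-monoʳ-≤ 5 (ℕ.+-monoˡ-≤ 7
  (s≤s (ℕ.*-monoˡ-≤ 8 n≤))))))))))))))))))

blowupTime-cubic : ∀ s → blowupTime s s s ≡ 8 * s ^ 3 + 14 * s ^ 2 + 33 * s + 29
blowupTime-cubic = solve 1 (λ s →
  con 8 :+ (con 1 :+ s :* con 5 :+ (con 2 :+ (con 1 :+ s :* con 4 :+ (con 12 :+ (con 1 :+ s :* con 15 :+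
  (con 3 :+ (con 1 :+ s :* (con 1 :+ (con 3 :+ (con 1 :+ s :* (con 1 :+ (con 5 :+
  (con 1 :+ s :* con 8 :+ con 7))) :+ con 4))))))))))
  := con 8 :* s :^ 3 :+ con 14 :* s :^ 2 :+ con 33 :* s :+ con 29) refl
  where open +-*-Solver

module Bounds (I : Instance) (n≥2 : 2 ≤ nV (G I)) where
  open Correctness I

  s n m N : ℕ
  s = size I
  n = nV (G I)
  m = nE (G I)
  N = suc m

  p≤s : p I ≤ s
  p≤s = ℕ.m≤n+m (p I) (n + m)
  n≤s : n ≤ s
  n≤s = ℕ.≤-trans (ℕ.m≤m+n n m) (ℕ.m≤m+n (n + m) (p I))
  N≤s : N ≤ s
  -- One vertex pays for the `1` in `N = 1 + m`.
  N≤s = ℕ.≤-trans (ℕ.+-monoˡ-≤ m (ℕ.≤-trans (s≤s z≤n) n≥2)) (ℕ.m≤m+n (n + m) (p I))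
  m≤s : m ≤ s
  m≤s = ℕ.<⇒≤ N≤s

  -- Here `84 = 8 + 14 + 33 + 29`, the coefficient sum in `blowupTime-cubic`.
  time-bound : blowupTime n m N ≤ 84 * s ^ 3 + 84
  time-bound = ℕ.≤-trans (blowupTime-mono n≤s m≤s N≤s)
    (ℕ.≤-trans (ℕ.≤-reflexive (blowupTime-cubic s)) (cubic-bound 8 14 33 29 s))

  size-bound : size I♯ ≤ 84 * s ^ 3 + 84
  size-bound = begin
    (N + N) * n + (m + N * (N * n)) + (p I + N * N)
      ≤⟨ ℕ.+-mono-≤ (ℕ.+-mono-≤ (ℕ.*-mono-≤ (ℕ.+-mono-≤ N≤s N≤s) n≤s)
           (ℕ.+-mono-≤ m≤s (ℕ.*-mono-≤ N≤s (ℕ.*-mono-≤ N≤s n≤s))))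
           (ℕ.+-mono-≤ p≤s (ℕ.*-mono-≤ N≤s N≤s)) ⟩
    (s + s) * s + (s + s * (s * s)) + (s + s * s)
      ≡⟨ solve 1 (λ s → (s :+ s) :* s :+ (s :+ s :* (s :* s)) :+ (s :+ s :* s) :=
                   con 1 :* s :^ 3 :+ con 3 :* s :^ 2 :+ con 2 :* s :+ con 0) refl s ⟩
    1 * s ^ 3 + 3 * s ^ 2 + 2 * s + 0
      ≤⟨ cubic-bound 1 3 2 0 s ⟩
    6 * s ^ 3 + 6
      -- Loosened to `84 = 6 + 78`, so that one constant bounds both size and time.
      ≤⟨ ℕ.+-mono-≤ (ℕ.*-monoˡ-≤ (s ^ 3) (ℕ.m≤m+n 6 78)) (ℕ.m≤m+n 6 78) ⟩
    84 * s ^ 3 + 84 ∎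
    where
    open ℕ.≤-Reasoning
    open +-*-Solver

lemma6p2 : Σ[ P ∈ Program ] Σ[ c ∈ ℕ ] Σ[ k ∈ ℕ ]
    ((I : Instance) → Loopless (G I) → (n≥2 : 2 ≤ nV (G I)) →
    Σ[ I♯ ∈ Instance ]
    ConstructsWithin P (c * size I ^ k + c) I I♯ ×
    Simple (G I♯) ×
    b I♯ ≡ b I ×
    (YesInstance I ⇔ YesInstance I♯) ×
    (Σ[ n♯≥2 ∈ 2 ≤ nV (G I♯) ]
    OPT (G I♯) n♯≥2 (χ I♯) ≡ OPT (G I) n≥2 (χ I)))
lemma6p2 = blowup , 84 , 3 , λ I loopless n≥2 →
  let open Correctness I
      open Bounds I n≥2 using (time-bound; size-bound)
      s , halts , out≡ = blowup-constructs
      -- As `N` is a successor, `(N + N) * n` unfolds to `n` plus a remainder.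
      n♯≥2 = ℕ.≤-trans n≥2 (ℕ.m≤m+n (nV (G I)) _)
  in I♯ , (size-bound , _ , s , halts , out≡ , time-bound) , simple loopless , refl ,
     yes⇔ n≥2 (b I) , n♯≥2 , OPT♯≡OPT n≥2 n♯≥2
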